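{- (ZF) For every Dedekind infinite set $A$, $|\mathrm{seq}(A)|<|\mathrm{Part}_{\mathrm{fin}}(A)|$; that is, there is an injection from $\mathrm{seq}(A)$ into $\mathrm{Part}_{\mathrm{fin}}(A)$ but no bijection between them.
   Context: Work in ZF (no Axiom of Choice). $\mathrm{seq}(A)$ is the set of all finite sequences of elements of $A$; $\mathrm{Part}_{\mathrm{fin}}(A)$ is the set of all partitions of $A$ all of whose blocks are finite. A set $A$ is Dedekind infinite if there is an injection from $\omega$ into $A$. $|X|<|Y|$ means there is an injection from $X$ into $Y$ and there is no bijection between $X$ and $Y$. -}

module Defs where

open import Data.Bool.Base using (Bool; T)
open import Data.Fin.Base using (Fin)
open import Data.List.Base using (List)
open import Data.Nat.Base using (ℕ)
open import Data.Product.Base using (_×_; ∃-syntax)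
open import Function.Bundles using (_↣_; _⤖_)
open import Level using (Level; suc; _⊔_)
open import Relation.Binary.PropositionalEquality.Core using (_≡_)
open import Relation.Nullary using (Dec; ¬_; Irrelevant)

private
  variable
    a b : Level

-- Choice-free classical logic.  Only types with at most one element are
-- decided: deciding every type (as Axiom.ExcludedMiddle does) would pick an
-- element from each nonempty type and so yield the Axiom of Choice.
PropositionalExcludedMiddle : (ℓ : Level) → Set (suc ℓ)
PropositionalExcludedMiddle ℓ = {P : Set ℓ} → Irrelevant P → Dec P

-- Mere existence.  An untruncated witness inside a definition such as
-- "every block is finite" would amount to a choice of witnesses, one for each
-- block.  Given function extensionality and propositional excluded middle,
-- double negation is propositional truncation.
∥_∥ : Set a → Set a
∥ P ∥ = ¬ ¬ P

-- The power set: by propositional excluded middle, every subset has a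
-- characteristic function, and by function extensionality equality of
-- characteristic functions is equality of subsets.
𝒫 : Set a → Set a
𝒫 A = A → Bool

infix 4 _∈_
_∈_ : {A : Set a} → A → 𝒫 A → Set
x ∈ S = T (S x)

Finite : {A : Set a} → 𝒫 A → Set a
Finite S = ∥ ∃[ n ] (Fin n ⤖ (∃[ x ] x ∈ S)) ∥

record IsPartition {A : Set a} (Π : 𝒫 (𝒫 A)) : Set a where
  field
    nonempty : ∀ B → B ∈ Π → ∥ ∃[ x ] x ∈ B ∥
    disjoint : ∀ B C → B ∈ Π → C ∈ Π → ∀ x → x ∈ B → x ∈ C → B ≡ C
    covering : ∀ x → ∥ ∃[ B ] (B ∈ Π × x ∈ B) ∥

-- Under function extensionality the second component is a proposition, so
-- _≡_ on Partfin A is equality of the underlying families of blocks.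
Partfin : Set a → Set a
Partfin A = ∃[ Π ] (IsPartition {A = A} Π × (∀ B → B ∈ Π → Finite B))

DedekindInfinite : Set a → Set a
DedekindInfinite A = ℕ ↣ A

seq : Set a → Set a
seq = List

infix 4 _≺_
_≺_ : Set a → Set b → Set (a ⊔ b)
X ≺ Y = (X ↣ Y) × ¬ (X ⤖ Y)

{-# OPTIONS --safe #-}
module Submission where

-- Fix an injection f from ℕ into A.  A sequence s is coded by a partition in which
-- x shares a block with (a copy of) the positions at which s takes the value x.
--
-- For the converse, let g inject Partfin A into seq A, and let E be a well-ordered
-- subset of the complement of f(ℕ).  There is a canonical injection of the finite
-- sequences in O = f(ℕ) ∪ E into O, so each such sequence s can be given two private
-- points of O; diagonalising over whether the partition with code s identifies them
-- yields a partition whose code is not a sequence in O, and the first entry of that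
-- code outside O is a new element, chosen canonically from E and its order.  As in
-- Zermelo's proof of the well-ordering theorem, the well-orders all of whose elements
-- are chosen in this way agree with one another, so their union is the largest of
-- them, yet choosing once more extends it.

open import Axiom.Extensionality.Propositional using (Extensionality; lower-extensionality)
open import Axiom.UniquenessOfIdentityProofs.WithK using (uip)
open import Data.Bool.Base using (Bool; true; false; T)
open import Data.Empty using (⊥; ⊥-elim; ⊥-elim-irr)
open import Data.Fin.Base using (Fin; zero; suc; fromℕ<; combine)
open import Data.Fin.Properties using (fromℕ<-injective; combine-injective; ℕ→Fin-notInjective)
open import Data.List.Base using (List; []; _∷_; length; map; lookup; filter; applyUpTo; deduplicate)
open import Data.List.Membership.Propositional using () renaming (_∈_ to _∈ₗ_)
open import Data.List.Membership.Propositional.Properties using (∈-filter⁺; ∈-filter⁻; ∈-deduplicate⁺; ∈-deduplicate⁻; ∈-lookup; ∈-applyUpTo⁺)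
open import Data.List.Properties using (∷-injectiveˡ; ∷-injectiveʳ)
import Data.List.Relation.Unary.All as All
open import Data.List.Relation.Unary.Any using (here; there; index)
open import Data.List.Relation.Unary.Any.Properties using (lookup-index)
open import Data.List.Relation.Unary.Unique.DecPropositional.Properties using (deduplicate-!)
open import Data.List.Relation.Unary.Unique.Propositional using (Unique; _∷_)
open import Data.Maybe.Base using (Maybe; just; nothing)
open import Data.Maybe.Properties using (just-injective)
open import Data.Nat.Base using (ℕ; zero; suc; _*_; _<_; s≤s; z≤n)
open import Data.Nat.Induction using (<-wellFounded)
open import Data.Nat.Properties using (<-cmp; ≮⇒≥; *-cancelˡ-≡; suc-injective; even≢odd)
open import Data.Product.Base using (Σ; _×_; _,_; proj₁; proj₂; ∃; ∃-syntax; -,_)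
open import Data.Product.Function.NonDependent.Propositional using (_×-↣_)
open import Data.Product.Relation.Binary.Lex.Strict using (×-Lex; ×-wellFounded)
open import Data.Sum.Base as Sum using (_⊎_; inj₁; inj₂)
open import Data.Sum.Properties using (inj₁-injective; inj₂-injective)
open import Data.Sum.Relation.Binary.LeftOrder using (_⊎-<_; ₁∼₂; ₁∼₁; ₂∼₂; ⊎-<-wellFounded)
open import Data.Unit.Base using (⊤; tt)
open import Function.Base using (_∘_; case_of_)
open import Function.Bundles using (_↣_; _⤖_; mk↣; mk⤖; module Injection; module Bijection)
open import Function.Construct.Composition using (_↣-∘_)
open import Function.Definitions using (Injective)
open import Induction.WellFounded using (Acc; acc; WellFounded; wf⇒asym)
open import Level using (Level; 0ℓ; _⊔_; Lift; lift) renaming (suc to lsuc)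
import Relation.Binary.Construct.On as On
open import Relation.Binary.Definitions using (DecidableEquality; tri<; tri≈; tri>)
open import Relation.Binary.PropositionalEquality
open import Relation.Nullary using (Dec; yes; no; ¬_; Irrelevant; contradiction)
open import Relation.Nullary.Decidable using (⌊_⌋; toWitness; fromWitness; T?)
open import Defs

-- Lists and their entries.

lookup-injective : ∀ {a} {A : Set a} {xs : List A} → Unique xs → Injective _≡_ _≡_ (lookup xs)
lookup-injective (_ ∷ _)   {zero}  {zero}  _ = refl
lookup-injective (x∉ ∷ _)  {zero}  {suc j} e = contradiction e (All.lookup x∉ (∈-lookup j))
lookup-injective (x∉ ∷ _)  {suc i} {zero}  e = contradiction (sym e) (All.lookup x∉ (∈-lookup i))
lookup-injective (_ ∷ xs!) {suc i} {suc j} e = cong suc (lookup-injective xs! e)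

infixl 20 _‼_
_‼_ : ∀ {a} {A : Set a} → List A → ℕ → Maybe A
[]       ‼ _     = nothing
(x ∷ _)  ‼ zero  = just x
(_ ∷ xs) ‼ suc i = xs ‼ i

‼⇒< : ∀ {a} {A : Set a} (xs : List A) {i x} → xs ‼ i ≡ just x → i < length xs
‼⇒< (_ ∷ _)  {zero}  _ = s≤s z≤n
‼⇒< (_ ∷ xs) {suc i} e = s≤s (‼⇒< xs e)

‼-extensional : ∀ {a} {A : Set a} (xs ys : List A) → (∀ i x → xs ‼ i ≡ just x → ys ‼ i ≡ just x) →
                (∀ i x → ys ‼ i ≡ just x → xs ‼ i ≡ just x) → xs ≡ ys
‼-extensional []       []       _ _ = refl
‼-extensional []       (y ∷ _)  _ g = case g 0 y refl of λ ()
‼-extensional (x ∷ _)  []       f _ = case f 0 x refl of λ ()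
‼-extensional (x ∷ xs) (y ∷ ys) f g with refl ← f 0 x refl =
  cong (x ∷_) (‼-extensional xs ys (f ∘ suc) (g ∘ suc))

-- Well-orders, their products and sums.

record WellOrder {x} (ℓ : Level) (X : Set x) : Set (x ⊔ lsuc ℓ) where
  infix 4 _⊏_
  field
    _⊏_         : X → X → Set ℓ
    wellFounded : WellFounded _⊏_
    compare     : ∀ x y → x ⊏ y ⊎ x ≡ y ⊎ y ⊏ x

  ⊏-asym : ∀ {x y} → x ⊏ y → ¬ y ⊏ x
  ⊏-asym = wf⇒asym wellFounded

  ⊏-irrefl : ∀ {x} → ¬ x ⊏ x
  ⊏-irrefl x⊏x = ⊏-asym x⊏x x⊏x

  -- In the case `z ⊏ x` the three points form a cycle, which can be rotated to start from ever
  -- smaller points, against accessibility.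
  ⊏-trans : ∀ {x y z} → x ⊏ y → y ⊏ z → x ⊏ z
  ⊏-trans {x} {y} {z} x⊏y y⊏z with compare x z
  ... | inj₁ x⊏z         = x⊏z
  ... | inj₂ (inj₁ refl) = contradiction y⊏z (⊏-asym x⊏y)
  ... | inj₂ (inj₂ z⊏x)  = ⊥-elim (acyclic (wellFounded x) x⊏y y⊏z z⊏x)
    where
    acyclic : ∀ {x y z} → Acc _⊏_ x → x ⊏ y → y ⊏ z → ¬ z ⊏ x
    acyclic (acc rs) x⊏y y⊏z z⊏x = acyclic (rs z⊏x) z⊏x x⊏y y⊏z

ℕ-wellOrder : WellOrder 0ℓ ℕ
ℕ-wellOrder = record { _⊏_ = _<_ ; wellFounded = <-wellFounded ; compare = compare }
  where
  compare : ∀ m n → m < n ⊎ m ≡ n ⊎ n < m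
  compare m n with <-cmp m n
  ... | tri< m<n _ _ = inj₁ m<n
  ... | tri≈ _ m≡n _ = inj₂ (inj₁ m≡n)
  ... | tri> _ _ n<m = inj₂ (inj₂ n<m)

module _ {x y ℓ : Level} {X : Set x} {Y : Set y} where

  pullback : WellOrder ℓ Y → X ↣ Y → WellOrder ℓ X
  pullback W X↣Y = record
    { _⊏_         = λ p q → to p ⊏ to q
    ; wellFounded = On.wellFounded to wellFounded
    ; compare     = λ p q → Sum.map₂ (Sum.map₁ injective) (compare (to p) (to q))
    }
    where
    open WellOrder W
    open Injection X↣Y using (to; injective)

  infixr 2 _×-wellOrder_
  _×-wellOrder_ : WellOrder (x ⊔ ℓ) X → WellOrder ℓ Y → WellOrder (x ⊔ ℓ) (X × Y)
  V ×-wellOrder W = record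
    { _⊏_         = ×-Lex _≡_ V._⊏_ W._⊏_
    ; wellFounded = ×-wellFounded V.wellFounded W.wellFounded
    ; compare     = compare
    }
    where
    module V = WellOrder V
    module W = WellOrder W
    compare : ∀ p q → ×-Lex _≡_ V._⊏_ W._⊏_ p q ⊎ p ≡ q ⊎ ×-Lex _≡_ V._⊏_ W._⊏_ q p
    compare (p₁ , p₂) (q₁ , q₂) with V.compare p₁ q₁
    ... | inj₁ l           = inj₁ (inj₁ l)
    ... | inj₂ (inj₂ g)    = inj₂ (inj₂ (inj₁ g))
    ... | inj₂ (inj₁ refl) =
      Sum.map (λ l → inj₂ (refl , l)) (Sum.map (cong (p₁ ,_)) (λ g → inj₂ (refl , g))) (W.compare p₂ q₂)

infixr 1 _⊎-wellOrder_
_⊎-wellOrder_ : ∀ {x y ℓ₁ ℓ₂} {X : Set x} {Y : Set y} →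
                WellOrder ℓ₁ X → WellOrder ℓ₂ Y → WellOrder (x ⊔ y ⊔ ℓ₁ ⊔ ℓ₂) (X ⊎ Y)
V ⊎-wellOrder W = record
  { _⊏_         = V._⊏_ ⊎-< W._⊏_
  ; wellFounded = ⊎-<-wellFounded V.wellFounded W.wellFounded
  ; compare     = λ
    { (inj₁ p) (inj₁ q) → Sum.map ₁∼₁ (Sum.map (cong inj₁) ₁∼₁) (V.compare p q)
    ; (inj₁ p) (inj₂ q) → inj₁ ₁∼₂
    ; (inj₂ p) (inj₁ q) → inj₂ (inj₂ ₁∼₂)
    ; (inj₂ p) (inj₂ q) → Sum.map ₂∼₂ (Sum.map (cong inj₂) ₂∼₂) (W.compare p q)
    }
  }
  where
  module V = WellOrder V
  module W = WellOrder W

-- Pairs ordered by their maximum first, so that the predecessors of (x , y)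
-- have both components bounded by the maximum of x and y.
module SquareOrder {a : Level} {U : Set a} (W : WellOrder a U) where
  open WellOrder W

  _⊔ᵂ_ : U → U → U
  x ⊔ᵂ y with compare x y
  ... | inj₁ _ = y
  ... | inj₂ _ = x

  ⊔ᵂ-upperˡ : ∀ x y → ¬ x ⊔ᵂ y ⊏ x
  ⊔ᵂ-upperˡ x y with compare x y
  ... | inj₁ x⊏y = ⊏-asym x⊏y
  ... | inj₂ _   = ⊏-irrefl

  ⊔ᵂ-upperʳ : ∀ x y → ¬ x ⊔ᵂ y ⊏ y
  ⊔ᵂ-upperʳ x y with compare x y
  ... | inj₁ _           = ⊏-irrefl
  ... | inj₂ (inj₁ refl) = ⊏-irrefl
  ... | inj₂ (inj₂ y⊏x)  = ⊏-asym y⊏x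

  square : WellOrder a (U × U)
  square = pullback (W ×-wellOrder W ×-wellOrder W) (mk↣ {to = λ (x , y) → x ⊔ᵂ y , x , y} (cong proj₂))

  square-bounded : ∀ {x y a b} → WellOrder._⊏_ square (x , y) (a , b) →
                   ¬ a ⊔ᵂ b ⊏ x × ¬ a ⊔ᵂ b ⊏ y
  square-bounded {x} {y} (inj₁ m⊏c) =
    ⊔ᵂ-upperˡ x y ∘ ⊏-trans m⊏c , ⊔ᵂ-upperʳ x y ∘ ⊏-trans m⊏c
  square-bounded {x} {y} (inj₂ (m≡c , _)) =
    subst (λ c → ¬ c ⊏ x) m≡c (⊔ᵂ-upperˡ x y) , subst (λ c → ¬ c ⊏ y) m≡c (⊔ᵂ-upperʳ x y)

-- Classical logic without choice.

module _ {a : Level} (ext : Extensionality a a) (pem : PropositionalExcludedMiddle a) where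

  ext₀ : Extensionality a 0ℓ
  ext₀ = lower-extensionality 0ℓ a ext

  ¬-irrelevant : {P : Set a} → Irrelevant (¬ P)
  ¬-irrelevant ¬p _ = ext₀ (λ p → ⊥-elim (¬p p))

  stable : {P : Set a} → Irrelevant P → ∥ P ∥ → P
  stable irr ¬¬p with pem irr
  ... | yes p = p
  ... | no ¬p = ⊥-elim (¬¬p ¬p)

  -- Doubly negated, any type becomes a proposition that `pem` can decide, so this is the truth
  -- value of mere existence.
  ⟦_⟧ : Set a → Bool
  ⟦ P ⟧ = ⌊ pem {∥ P ∥} ¬-irrelevant ⌋

  ⟦⟧-intro : {P : Set a} → P → T ⟦ P ⟧
  ⟦⟧-intro p = fromWitness (λ ¬p → ¬p p)

  ⟦⟧-elim : {P : Set a} → T ⟦ P ⟧ → ∥ P ∥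
  ⟦⟧-elim = toWitness

  T-irrelevant : {b : Bool} → Irrelevant (T b)
  T-irrelevant {true} _ _ = refl

  T-stable : {b : Bool} → ¬ ¬ T b → T b
  T-stable {true}  _ = _
  T-stable {false} ¬¬t = ¬¬t (λ t → t)

  T-injective : {b c : Bool} → (T b → T c) → (T c → T b) → b ≡ c
  T-injective {true}  {true}  _ _ = refl
  T-injective {true}  {false} f _ = ⊥-elim (f _)
  T-injective {false} {true}  _ g = ⊥-elim (g _)
  T-injective {false} {false} _ _ = refl

  _≟_ : {X : Set a} → DecidableEquality X
  _ ≟ _ = pem uip

  -- Unique choice: a witness that is determined uniquely can be extracted by `pem` or `stable`,
  -- since the existential is then a proposition.
  ∃-irrelevant : ∀ {x p} {X : Set x} {P : X → Set p} → (∀ x y → P x → P y → x ≡ y) →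
                 (∀ x → Irrelevant (P x)) → Irrelevant (∃ P)
  ∃-irrelevant unique irr (x , p) (y , q) with refl ← unique x y p q = cong (x ,_) (irr x p q)

  -- Partitions into finite blocks.

  module _ {A : Set a} where

    -- The list may contain repetitions and points outside `S`; filtering and deduplicating it
    -- leaves an exact enumeration.
    listed⇒finite : (S : 𝒫 A) (xs : List A) → (∀ x → x ∈ S → x ∈ₗ xs) → Finite S
    listed⇒finite S xs all¬fin = λ ¬fin → ¬fin (length ys , mk⤖ (injective , surjective))
      where
      S? = λ x → T? (S x)
      ys = deduplicate _≟_ (filter S? xs)
      ys⊆S : ∀ {x} → x ∈ₗ ys → x ∈ S
      ys⊆S = proj₂ ∘ ∈-filter⁻ S? {xs = xs} ∘ ∈-deduplicate⁻ _≟_ _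
      element : _ → ∃[ x ] x ∈ S
      element i = lookup ys i , ys⊆S (∈-lookup i)
      injective : Injective _≡_ _≡_ element
      injective {i} {j} e = lookup-injective (deduplicate-! _≟_ (filter S? xs)) (cong proj₁ e)
      surjective : ∀ y → ∃[ i ] (∀ {j} → j ≡ i → element j ≡ y)
      surjective (x , x∈S) = index x∈ys , λ { refl → sym (element-≡ (lookup-index x∈ys)) }
        where
        x∈ys = ∈-deduplicate⁺ _≟_ (∈-filter⁺ S? (all¬fin x x∈S) x∈S)
        element-≡ : ∀ {y} {p : x ∈ S} {q : y ∈ S} → x ≡ y → (x , p) ≡ (y , q)
        element-≡ refl = cong (x ,_) (T-irrelevant _ _)

    Together : Partfin A → A → A → Set a
    Together (Π , _) x y = ∥ ∃[ B ] (B ∈ Π × x ∈ B × y ∈ B) ∥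

    module Kernel (key : A → A) (fibre : ∀ z → ∥ ∃[ xs ] (∀ x → key x ≡ z → x ∈ₗ xs) ∥) where

      class : A → 𝒫 A
      class z x = ⟦ key x ≡ z ⟧

      class⇒≡ : ∀ {x z} → x ∈ class z → key x ≡ z
      class⇒≡ = stable uip ∘ ⟦⟧-elim

      blocks : 𝒫 (𝒫 A)
      blocks B = ⟦ ∃[ x ] B ≡ class (key x) ⟧

      isPartition : IsPartition blocks
      isPartition = record
        { nonempty = λ B B∈ ¬ne → ⟦⟧-elim B∈ λ { (x , refl) → ¬ne (x , ⟦⟧-intro refl) }
        ; disjoint = λ B C B∈ C∈ z z∈B z∈C → stable uip λ B≢C →
            ⟦⟧-elim B∈ λ { (x , refl) → ⟦⟧-elim C∈ λ { (y , refl) →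
              B≢C (cong class (trans (sym (class⇒≡ z∈B)) (class⇒≡ z∈C))) } }
        ; covering = λ x ¬cov → ¬cov (class (key x) , ⟦⟧-intro (x , refl) , ⟦⟧-intro refl)
        }

      partition : Partfin A
      partition = blocks , isPartition , λ B B∈ ¬fin → ⟦⟧-elim B∈ λ { (x , refl) →
        fibre (key x) λ { (xs , listed) →
          listed⇒finite (class (key x)) xs (λ y → listed y ∘ class⇒≡) ¬fin } }

      together : ∀ {x y} → key x ≡ key y → Together partition x y
      together {x} e ¬tog = ¬tog (class (key x) , ⟦⟧-intro (x , refl) , ⟦⟧-intro refl , ⟦⟧-intro (sym e))

      together⇒≡ : ∀ {x y} → Together partition x y → key x ≡ key y
      together⇒≡ tog = stable uip λ x≢y → tog λ { (B , B∈ , x∈B , y∈B) → ⟦⟧-elim B∈ λ { (z , refl) →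
        x≢y (trans (class⇒≡ x∈B) (sym (class⇒≡ y∈B))) } }

    -- Each `from i` is glued to the centre `to i`, and nothing else is glued. Several `i` may share
    -- a centre; `disjoint` keeps the centres fixed, and `listed` lets only finitely many points be
    -- moved to each.
    module Graft {I : Set a} (from to : I → A) (from-injective : Injective _≡_ _≡_ from)
                 (disjoint : ∀ i j → from i ≢ to j)
                 (listed : ∀ z → ∥ ∃[ xs ] (∀ i → to i ≡ z → from i ∈ₗ xs) ∥) where

      moved? : ∀ y → Dec (∃[ i ] from i ≡ y)
      moved? y = pem (∃-irrelevant (λ i j p q → from-injective (trans p (sym q))) (λ _ → uip))

      key : A → A
      key y with moved? y
      ... | yes (i , _) = to i
      ... | no _        = y

      key-from : ∀ i → key (from i) ≡ to i
      key-from i with moved? (from i)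
      ... | yes (j , e) = cong to (from-injective e)
      ... | no ¬moved   = contradiction (i , refl) ¬moved

      key-fixed : ∀ {y} → (∀ i → from i ≢ y) → key y ≡ y
      key-fixed {y} fixed with moved? y
      ... | yes (i , e) = contradiction e (fixed i)
      ... | no _        = refl

      fibre : ∀ z → ∥ ∃[ xs ] (∀ x → key x ≡ z → x ∈ₗ xs) ∥
      -- Besides the points moved to `z`, the fibre can contain only `z` itself.
      fibre z ¬fib = listed z λ { (xs , all) → ¬fib (z ∷ xs , member all) }
        where
        member : ∀ {xs} → (∀ i → to i ≡ z → from i ∈ₗ xs) → ∀ x → key x ≡ z → x ∈ₗ z ∷ xs
        member all x e with moved? x
        ... | yes (i , refl) = there (all i e)
        ... | no _           = here e

      open Kernel key fibre public using (partition; together; together⇒≡)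

      together-graft : ∀ i → Together partition (from i) (to i)
      together-graft i = together (trans (key-from i) (sym (key-fixed (λ j → disjoint j i))))

      together-fixed : ∀ {x y} → (∀ i → from i ≢ x) → (∀ i → from i ≢ y) → Together partition x y → x ≡ y
      together-fixed fx fy tog = trans (sym (key-fixed fx)) (trans (together⇒≡ tog) (key-fixed fy))

  -- Injecting finite sequences into partitions.

  module _ {A : Set a} (ℕ↣A : DedekindInfinite A) where

    open Injection ℕ↣A using () renaming (to to f; injective to f-injective)

    natural? : ∀ x → Dec (∃[ n ] f n ≡ x)
    natural? x = pem (∃-irrelevant (λ m n p q → f-injective (trans p (sym q))) (λ _ → uip))

    even : ℕ → A
    even n = f (2 * n)

    even-injective : Injective _≡_ _≡_ even
    even-injective {m} {n} e = *-cancelˡ-≡ m n 2 (f-injective e)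

    -- As in Hilbert's hotel, `f n` moves to `f (2n+1)`, which frees the even places of `f` for
    -- coding positions.
    avoidEven : A → A
    avoidEven x with natural? x
    ... | yes (n , _) = f (suc (2 * n))
    ... | no _        = x

    avoidEven-injective : Injective _≡_ _≡_ avoidEven
    avoidEven-injective {x} {y} e with natural? x | natural? y
    ... | yes (m , refl) | yes (n , refl) = cong f (*-cancelˡ-≡ m n 2 (suc-injective (f-injective e)))
    ... | yes (m , refl) | no ¬nat        = contradiction (-, e) ¬nat
    ... | no ¬nat        | yes (n , refl) = contradiction (-, sym e) ¬nat
    ... | no _           | no _           = e

    even≢avoidEven : ∀ n x → even n ≢ avoidEven x
    even≢avoidEven n x e with natural? x
    ... | yes (m , refl) = even≢odd n m (f-injective e)
    ... | no ¬nat        = ¬nat (-, e)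

    -- The sequence s becomes the partition whose nontrivial blocks are {x} ∪ {i : sᵢ = x},
    -- where elements and positions are coded disjointly by avoidEven and even.
    module SeqPartition (s : seq A) where

      Entry : Set a
      Entry = ∃[ i ] ∃[ x ] s ‼ i ≡ just x

      entry-≡ : {p q : Entry} → proj₁ p ≡ proj₁ q → p ≡ q
      entry-≡ {i , x , p} {_ , y , q} refl with refl ← trans (sym p) q = cong (λ r → i , x , r) (uip p q)

      open Graft {I = Entry} (λ (i , _) → even i) (λ (_ , x , _) → avoidEven x)
        (λ e → entry-≡ (even-injective e)) (λ (i , _) (_ , x , _) → even≢avoidEven i x)
        -- One list serves every `z`: only the first `length s` even points are moved at all.
        (λ z ¬listed → ¬listed (applyUpTo even (length s) ,
          λ (i , x , e) _ → ∈-applyUpTo⁺ even (‼⇒< s e))) public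

      -- The sequence can be read back from its partition. If `y` is the entry at `i`, then `even i`
      -- has key `avoidEven y`, which forces `x ≡ y`. Past the end of `s` neither point is moved, so
      -- they could share a block only by being equal.
      together⇒‼ : ∀ i x → Together partition (even i) (avoidEven x) → s ‼ i ≡ just x
      together⇒‼ i x tog with s ‼ i in e
      ... | just y = cong just (avoidEven-injective (begin
        avoidEven y       ≡⟨ key-from (i , y , e) ⟨
        key (even i)      ≡⟨ together⇒≡ tog ⟩
        key (avoidEven x) ≡⟨ key-fixed (λ (j , _) → even≢avoidEven j x) ⟩
        avoidEven x       ∎))
        where open ≡-Reasoning
      ... | nothing = contradiction
        (together-fixed (λ (j , y , p) q → case trans (sym p) (trans (cong (s ‼_) (even-injective q)) e) of λ ())
                        (λ (j , _) → even≢avoidEven j x) tog)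
        (even≢avoidEven i x)

    seq↣Partfin : seq A ↣ Partfin A
    seq↣Partfin = mk↣ {to = SeqPartition.partition} λ {s} {t} e →
      ‼-extensional s t (λ i x p → entry-transfer e p) (λ i x p → entry-transfer (sym e) p)
      where
      entry-transfer : ∀ {s t i x} → SeqPartition.partition s ≡ SeqPartition.partition t →
                       s ‼ i ≡ just x → t ‼ i ≡ just x
      entry-transfer {s} {t} {i} {x} e p = SeqPartition.together⇒‼ t i x
        (subst (λ π → Together π (even i) (avoidEven x)) e (SeqPartition.together-graft s (i , x , p)))

  -- Minima, comparison and pairing for well-orders.

  acc-irrelevant : ∀ {X : Set a} {_⊏_ : X → X → Set a} {x} → Irrelevant (Acc _⊏_ x)
  acc-irrelevant (acc rs) (acc qs) =
    cong (λ h → acc λ {y} → h y) (ext λ y → ext λ l → acc-irrelevant (rs l) (qs l))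

  module Minimum {X : Set a} (W : WellOrder a X) (Q : X → Set a) where
    open WellOrder W

    -- The truncation of `Q x` makes minimality a proposition, so the unique minimal element can be
    -- extracted without choice.
    Minimal : X → Set a
    Minimal x = ∥ Q x ∥ × (∀ y → y ⊏ x → ¬ Q y)

    minimal-irrelevant : Irrelevant (∃ Minimal)
    minimal-irrelevant = ∃-irrelevant unique λ x (p , p′) (q , q′) →
      cong₂ _,_ (¬-irrelevant p q) (ext λ y → ext λ l → ¬-irrelevant (p′ y l) (q′ y l))
      where
      unique : ∀ x y → Minimal x → Minimal y → x ≡ y
      unique x y (p , p′) (q , q′) with compare x y
      ... | inj₁ x⊏y        = contradiction (q′ x x⊏y) p
      ... | inj₂ (inj₁ x≡y) = x≡y
      ... | inj₂ (inj₂ y⊏x) = contradiction (p′ y y⊏x) q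

    minimal? : Dec (∃ Minimal)
    minimal? = pem minimal-irrelevant

    minimum : ∥ ∃ Q ∥ → ∃ Minimal
    minimum ex = stable minimal-irrelevant λ ¬min → ex λ (x , q) → none ¬min (wellFounded x) q
      where
      none : ¬ ∃ Minimal → ∀ {x} → Acc _⊏_ x → ¬ Q x
      none ¬min (acc rs) q = ¬min (-, (λ ¬q → ¬q q) , λ y l → none ¬min (rs l))

  open Minimum using (minimal?; minimum)

  -- Enumerate V into U by always taking the least element of U not yet used.
  module Comparison {U V : Set a} (WU : WellOrder a U) (WV : WellOrder a V) where
    open WellOrder WV

    least : (U → Set a) → Maybe U
    least Q with minimal? WU Q
    ... | yes (u , _) = just u
    ... | no _        = nothing

    least-just : ∀ Q {u} → least Q ≡ just u → ∥ Q u ∥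
    least-just Q e with minimal? WU Q
    least-just Q refl | yes (_ , q , _) = q

    least-nothing : ∀ Q → least Q ≡ nothing → ∀ u → ¬ Q u
    least-nothing Q e u q with minimal? WU Q
    ... | no ¬min = ¬min (minimum WU Q λ ¬q → ¬q (u , q))

    Fresh : ∀ v → (∀ v′ → v′ ⊏ v → Maybe U) → U → Set a
    Fresh v h u = ∀ v′ (l : v′ ⊏ v) → h v′ l ≢ just u

    enumᴬ : ∀ v → Acc _⊏_ v → Maybe U
    enumᴬ v (acc rs) = least (Fresh v λ v′ l → enumᴬ v′ (rs l))

    enum : V → Maybe U
    enum v = enumᴬ v (wellFounded v)

    enum-unfold : ∀ v → enum v ≡ least (Fresh v λ v′ _ → enum v′)
    enum-unfold v with wellFounded v
    -- The recursive calls carry the accessibility proofs `rs l`, which equal the ones used by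
    -- `enum`.
    ... | acc rs = cong (λ h → least (Fresh v h))
                        (ext λ v′ → ext λ l → cong (enumᴬ v′) (acc-irrelevant (rs l) (wellFounded v′)))

    enum-fresh : ∀ {v v′ u} → v′ ⊏ v → enum v ≡ just u → enum v′ ≢ just u
    enum-fresh l e e′ = least-just _ (trans (sym (enum-unfold _)) e) λ fresh → fresh _ l e′

    enum-injective : ∀ v v′ {u} → enum v ≡ just u → enum v′ ≡ just u → v ≡ v′
    enum-injective v v′ e e′ with compare v v′
    ... | inj₁ v⊏v′        = contradiction e (enum-fresh v⊏v′ e′)
    ... | inj₂ (inj₁ v≡v′) = v≡v′
    ... | inj₂ (inj₂ v′⊏v) = contradiction e′ (enum-fresh v′⊏v e)

    -- If the enumeration never runs out, it injects `V` into `U`. If it has run out at `v`, no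
    -- element of `U` is still fresh there, so each has an index below `v`, and these indices embed
    -- `U`.
    comparison : (V ↣ U) ⊎ ∃[ v ] Σ (U ↣ V) λ U↣V → ∀ u → ∥ Injection.to U↣V u ⊏ v ∥
    comparison with pem {¬ (∃[ v ] enum v ≡ nothing)} ¬-irrelevant
    ... | yes total = inj₁ (mk↣ {to = proj₁ ∘ value}
                              λ {v} {v′} e → enum-injective v v′ (proj₂ (value v)) (trans (proj₂ (value v′)) (cong just (sym e))))
      where
      value : ∀ v → ∃[ u ] enum v ≡ just u
      value v with enum v in e
      ... | just u  = u , refl
      ... | nothing = contradiction (v , e) total
    -- Leastness makes `v` unique, so it can be obtained from its doubly negated existence.
    ... | no ¬total with minimum WV (λ v → enum v ≡ nothing) ¬total
    ... | v , v-nothing , _ =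
      inj₂ (v , mk↣ {to = proj₁ ∘ index′} (λ {u} {u′} → index′-injective u u′) , proj₂ ∘ proj₂ ∘ index′)
      where
      index′ : ∀ u → ∃[ v′ ] (enum v′ ≡ just u × ∥ v′ ⊏ v ∥)
      index′ u = stable
        (∃-irrelevant (λ v₁ v₂ (e₁ , _) (e₂ , _) → enum-injective v₁ v₂ e₁ e₂)
                      (λ _ (e₁ , l₁) (e₂ , l₂) → cong₂ _,_ (uip e₁ e₂) (¬-irrelevant l₁ l₂)))
        λ unhit → v-nothing λ e → least-nothing _ (trans (sym (enum-unfold v)) e) u
          λ v′ l e′ → unhit (v′ , e′ , λ ¬l → ¬l l)
      index′-injective : ∀ u u′ → proj₁ (index′ u) ≡ proj₁ (index′ u′) → u ≡ u′
      index′-injective u u′ e = just-injective (begin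
        just u                  ≡⟨ proj₁ (proj₂ (index′ u)) ⟨
        enum (proj₁ (index′ u)) ≡⟨ cong enum e ⟩
        enum (proj₁ (index′ u′)) ≡⟨ proj₁ (proj₂ (index′ u′)) ⟩
        just u′                 ∎)
        where open ≡-Reasoning

  -- A canonical pairing on ℕ ⊎ W: either enumerating the square never runs out
  -- of elements, or ℕ ⊎ W embeds into the square of a proper initial segment.
  module Pairing {W : Set a} (WO : WellOrder a W)
                 (⊏-irrelevant : ∀ {x y} → Irrelevant (WellOrder._⊏_ WO x y)) where
    open WellOrder WO

    Below : (W → Set a) → Set a
    Below D = ℕ ⊎ ∃ D

    HasPairing : (W → Set a) → Set a
    HasPairing D = (Below D × Below D) ↣ Below D

    -- The inductive step is stated for an arbitrary initial segment `D`, so that it serves both for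
    -- the segments `_⊏ x` and, at the end, for all of `W`.
    module Step (D : W → Set a) (D-irrelevant : ∀ {x} → Irrelevant (D x))
                (D-initial : ∀ {x y} → D x → y ⊏ x → D y)
                (D-pairing : ∀ {x} → D x → HasPairing (_⊏ x)) where

      element-≡ : ∀ {x y p q} → x ≡ y → _≡_ {A = ∃ D} (x , p) (y , q)
      element-≡ refl = cong (-,_) (D-irrelevant _ _)

      below : WellOrder a (Below D)
      below = ℕ-wellOrder ⊎-wellOrder pullback WO (mk↣ {to = proj₁} element-≡)

      module B = WellOrder below
      open SquareOrder below

      bounded-by-ℕ : ∀ n u → ¬ inj₁ n B.⊏ u → Fin (suc n)
      bounded-by-ℕ n (inj₁ m) u⊑n = fromℕ< (s≤s (≮⇒≥ (u⊑n ∘ ₁∼₁)))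
      bounded-by-ℕ n (inj₂ _) u⊑n = contradiction ₁∼₂ u⊑n

      bounded-by-ℕ-injective : ∀ n u v {u⊑n v⊑n} → bounded-by-ℕ n u u⊑n ≡ bounded-by-ℕ n v v⊑n → u ≡ v
      bounded-by-ℕ-injective n (inj₁ _) (inj₁ _) e = cong inj₁ (fromℕ<-injective _ _ _ _ e)
      bounded-by-ℕ-injective n (inj₁ _) (inj₂ _) {v⊑n = v⊑n} _ = contradiction ₁∼₂ v⊑n
      bounded-by-ℕ-injective n (inj₂ _) _ {u⊑n} _ = contradiction ₁∼₂ u⊑n

      -- The closed segment up to `x` has just one point more than the open one: `x` goes to the
      -- natural number 0, and the naturals shift by one to make room.
      bounded-by-W : ∀ x dx u → ¬ inj₂ (x , dx) B.⊏ u → Below (_⊏ x)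
      bounded-by-W x dx (inj₁ m) _ = inj₁ (suc m)
      bounded-by-W x dx (inj₂ (y , _)) u⊑x with compare y x
      ... | inj₁ y⊏x        = inj₂ (y , y⊏x)
      ... | inj₂ (inj₁ _)   = inj₁ 0
      ... | inj₂ (inj₂ x⊏y) = contradiction (₂∼₂ x⊏y) u⊑x

      bounded-by-W-injective : ∀ x dx u v {u⊑x v⊑x} →
                               bounded-by-W x dx u u⊑x ≡ bounded-by-W x dx v v⊑x → u ≡ v
      bounded-by-W-injective x dx (inj₁ _) (inj₁ _) refl = refl
      bounded-by-W-injective x dx (inj₁ _) (inj₂ (z , _)) {v⊑x = v⊑x} e with compare z x
      bounded-by-W-injective x dx (inj₁ _) (inj₂ (z , _)) () | inj₁ _
      bounded-by-W-injective x dx (inj₁ _) (inj₂ (z , _)) () | inj₂ (inj₁ _)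
      ... | inj₂ (inj₂ x⊏z) = contradiction (₂∼₂ x⊏z) v⊑x
      bounded-by-W-injective x dx (inj₂ (y , _)) (inj₁ _) {u⊑x} e with compare y x
      bounded-by-W-injective x dx (inj₂ (y , _)) (inj₁ _) () | inj₁ _
      bounded-by-W-injective x dx (inj₂ (y , _)) (inj₁ _) () | inj₂ (inj₁ _)
      ... | inj₂ (inj₂ x⊏y) = contradiction (₂∼₂ x⊏y) u⊑x
      bounded-by-W-injective x dx (inj₂ (y , _)) (inj₂ (z , _)) {u⊑x} {v⊑x} e with compare y x | compare z x
      ... | inj₂ (inj₂ x⊏y) | _                   = contradiction (₂∼₂ x⊏y) u⊑x
      ... | _               | inj₂ (inj₂ x⊏z)     = contradiction (₂∼₂ x⊏z) v⊑x
      ... | inj₂ (inj₁ y≡x) | inj₂ (inj₁ z≡x)     = cong inj₂ (element-≡ (trans y≡x (sym z≡x)))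
      ... | inj₁ _          | inj₁ _ with refl ← e = cong inj₂ (element-≡ refl)

      weaken : ∀ {x} → D x → Below (_⊏ x) ↣ Below D
      weaken dx = mk↣ {to = Sum.map₂ (λ (y , y⊏x) → y , D-initial dx y⊏x)} λ
        { {inj₁ _} {inj₁ _} refl → refl
        ; {inj₂ (y , p)} {inj₂ (_ , q)} e → cong inj₂ (segment-≡ (cong proj₁ (inj₂-injective e))) }
        where
        segment-≡ : ∀ {x y z p q} → y ≡ z → _≡_ {A = ∃ (_⊏ x)} (y , p) (z , q)
        segment-≡ refl = cong (-,_) (⊏-irrelevant _ _)

      pairing : HasPairing D
      pairing with Comparison.comparison below square
      ... | inj₁ total = total
      ... | inj₂ ((a , b) , U↣U² , bounded) = escape (a ⊔ᵂ b) boundˡ boundʳ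
        where
        open Injection U↣U² using (to; injective)
        boundˡ : ∀ u → ¬ a ⊔ᵂ b B.⊏ proj₁ (to u)
        boundˡ u c⊏ = bounded u λ l → proj₁ (square-bounded l) c⊏
        boundʳ : ∀ u → ¬ a ⊔ᵂ b B.⊏ proj₂ (to u)
        boundʳ u c⊏ = bounded u λ l → proj₂ (square-bounded l) c⊏

        escape : ∀ c → (∀ u → ¬ c B.⊏ proj₁ (to u)) → (∀ u → ¬ c B.⊏ proj₂ (to u)) → HasPairing D
        -- Both coordinates are at most `n`, so ℕ would inject into a set of `(n+1)²` elements.
        escape (inj₁ n) l r = ⊥-elim (ℕ→Fin-notInjective (λ m → combine (i m) (j m)) code-injective)
          where
          i j : ℕ → Fin (suc n)
          i m = bounded-by-ℕ n _ (l (inj₁ m))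
          j m = bounded-by-ℕ n _ (r (inj₁ m))
          code-injective : Injective _≡_ _≡_ (λ m → combine (i m) (j m))
          code-injective {m} {m′} e with combine-injective (i m) (j m) (i m′) (j m′) e
          ... | i≡ , j≡ = inj₁-injective (injective (cong₂ _,_
            (bounded-by-ℕ-injective n _ _ i≡) (bounded-by-ℕ-injective n _ _ j≡)))
        -- `Below D` embeds into the square of the closed segment up to `x`, and so, by the pairing
        -- of the open segment, into that open segment. Applying this to both coordinates, pairing
        -- once more and including the result in `Below D` gives the pairing for `D`.
        escape (inj₂ (x , dx)) l r =
          (weaken dx ↣-∘ D-pairing dx) ↣-∘ (into-segment ×-↣ into-segment)
          where
          into-segment : Below D ↣ Below (_⊏ x)
          into-segment = D-pairing dx ↣-∘
            mk↣ {to = λ u → bounded-by-W x dx _ (l u) , bounded-by-W x dx _ (r u)}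
                λ e → injective (cong₂ _,_ (bounded-by-W-injective x dx _ _ (cong proj₁ e))
                                           (bounded-by-W-injective x dx _ _ (cong proj₂ e)))

    segment-pairing : ∀ {x} → Acc _⊏_ x → HasPairing (_⊏ x)
    segment-pairing (acc rs) =
      Step.pairing _ ⊏-irrelevant (λ y⊏x z⊏y → ⊏-trans z⊏y y⊏x) (λ y⊏x → segment-pairing (rs y⊏x))

    pairing : ((ℕ ⊎ W) × (ℕ ⊎ W)) ↣ (ℕ ⊎ W)
    pairing =
      (remove ↣-∘ Step.pairing (λ _ → Lift a ⊤) (λ _ _ → refl) _ (λ {x} _ → segment-pairing (wellFounded x)))
      ↣-∘ (add ×-↣ add)
      where
      remove : Below (λ _ → Lift a ⊤) ↣ (ℕ ⊎ W)
      remove = mk↣ {to = Sum.map₂ proj₁} λ { {inj₁ _} {inj₁ _} refl → refl ; {inj₂ _} {inj₂ _} refl → refl }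
      add : (ℕ ⊎ W) ↣ Below (λ _ → Lift a ⊤)
      add = mk↣ {to = Sum.map₂ (_, lift tt)} λ { {inj₁ _} {inj₁ _} refl → refl ; {inj₂ _} {inj₂ _} refl → refl }

  -- Coding finite sequences by single elements.

  module ListCode {O : Set a} (ℕ↣O : ℕ ↣ O) (pairing : (O × O) ↣ O) where
    open Injection ℕ↣O using () renaming (to to ν; injective to ν-injective)
    open Injection pairing using () renaming (to to pair; injective to pair-injective)

    fold : List O → O
    fold []       = ν 0
    fold (x ∷ xs) = pair (x , fold xs)

    fold-injective : ∀ xs ys → length xs ≡ length ys → fold xs ≡ fold ys → xs ≡ ys
    fold-injective []       []       _ _ = refl
    fold-injective (x ∷ xs) (y ∷ ys) l e with pair-injective e
    ... | p = cong₂ _∷_ (cong proj₁ p) (fold-injective xs ys (suc-injective l) (cong proj₂ p))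

    -- `fold` alone may fail to be injective, since `ν 0` may itself be a pair; recording the length
    -- reduces the matter to lists of equal length.
    listCode : List O ↣ O
    listCode = mk↣ {to = λ xs → pair (ν (length xs) , fold xs)} λ {xs} {ys} e →
      fold-injective xs ys (ν-injective (cong proj₁ (pair-injective e))) (cong proj₂ (pair-injective e))

  -- Zermelo's well-ordering argument.

  module Zermelo {B : Set a} where

    -- Boolean values keep `Relation` in `Set a`, so that `⋃Good` can quantify over all relations,
    -- and allow relations to be equal by extensionality.
    Relation : Set a
    Relation = B → B → Bool

    ⌜_⌝ : Relation → B → B → Set
    ⌜ R ⌝ x y = T (R x y)

    -- R is a reflexive well-order of the set {x : R x x}.  The axioms have stable
    -- conclusions, so the record can be recovered from an irrelevant copy of itself.
    record IsWellOrder (R : Relation) : Set a where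
      field
        reflˡ   : ∀ {x y} → ⌜ R ⌝ x y → ⌜ R ⌝ x x
        reflʳ   : ∀ {x y} → ⌜ R ⌝ x y → ⌜ R ⌝ y y
        antisym : ∀ {x y} → ⌜ R ⌝ x y → ⌜ R ⌝ y x → x ≡ y
        least   : ∀ (S : 𝒫 B) {x} → x ∈ S → ⌜ R ⌝ x x →
                  ∥ ∃[ m ] (m ∈ S × ⌜ R ⌝ m m × (∀ y → y ∈ S → ⌜ R ⌝ y y → ⌜ R ⌝ m y)) ∥

      leastSuch : ∀ (Q : B → Set a) {x} → Q x → ⌜ R ⌝ x x →
                  ∥ ∃[ m ] (∥ Q m ∥ × ⌜ R ⌝ m m × (∀ y → Q y → ⌜ R ⌝ y y → ⌜ R ⌝ m y)) ∥
      leastSuch Q q xx k = least (λ y → ⟦ Q y ⟧) (⟦⟧-intro q) xx λ (m , m∈ , mm , low) →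
        k (m , ⟦⟧-elim m∈ , mm , λ y → low y ∘ ⟦⟧-intro)

      total : ∀ {x y} → ⌜ R ⌝ x x → ⌜ R ⌝ y y → ⌜ R ⌝ x y ⊎ ⌜ R ⌝ y x
      total {x} {y} xx yy with T? (R x y)
      ... | yes xy = inj₁ xy
      ... | no ¬xy = inj₂ (T-stable λ ¬yx →
        leastSuch (λ z → z ≡ x ⊎ z ≡ y) (inj₁ refl) xx λ (m , q , _ , low) → q λ
          { (inj₁ refl) → ¬xy (low y (inj₂ refl) yy)
          ; (inj₂ refl) → ¬yx (low x (inj₁ refl) xx) })

      -- Whichever of the three points is the least among them, `x ≤ z` follows, by antisymmetry if
      -- it is `y` or `z`.
      trans-≤ : ∀ {x y z} → ⌜ R ⌝ x y → ⌜ R ⌝ y z → ⌜ R ⌝ x z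
      trans-≤ {x} {y} {z} xy yz = T-stable λ ¬xz →
        leastSuch (λ w → w ≡ x ⊎ w ≡ y ⊎ w ≡ z) (inj₁ refl) (reflˡ xy) λ (m , q , _ , low) → q λ
          { (inj₁ refl)        → ¬xz (low z (inj₂ (inj₂ refl)) (reflʳ yz))
          ; (inj₂ (inj₁ refl)) → ¬xz (subst (λ w → ⌜ R ⌝ w z) (antisym (low x (inj₁ refl) (reflˡ xy)) xy) yz)
          ; (inj₂ (inj₂ refl)) → ¬xz (subst (⌜ R ⌝ x) (antisym yz (low y (inj₂ (inj₁ refl)) (reflˡ yz))) xy) }

    open IsWellOrder

    Field : Relation → Set a
    Field R = ∃[ x ] ⌜ R ⌝ x x

    infix 4 _<[_]_
    _<[_]_ : B → Relation → B → Set a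
    x <[ R ] y = ⌜ R ⌝ x y × x ≢ y

    <-irrelevant : ∀ {R x y} → Irrelevant (x <[ R ] y)
    <-irrelevant (p , p′) (q , q′) = cong₂ _,_ (T-irrelevant p q) (¬-irrelevant p′ q′)

    ≤-<-trans : ∀ {R} → IsWellOrder R → ∀ {x y z} → ⌜ R ⌝ x y → y <[ R ] z → x <[ R ] z
    ≤-<-trans W xy (yz , y≢z) = trans-≤ W xy yz , λ { refl → y≢z (antisym W yz xy) }

    fieldOrder : ∀ {R} → IsWellOrder R → WellOrder a (Field R)
    fieldOrder {R} W = record
      { _⊏_         = λ (x , _) (y , _) → x <[ R ] y
      -- At a least inaccessible point, everything strictly below would be accessible.
      ; wellFounded = λ (x , xx) → stable acc-irrelevant λ ¬acc →
          leastSuch W (λ y → Σ (⌜ R ⌝ y y) λ yy → ¬ Acc _ (y , yy)) (xx , ¬acc) xx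
            λ (m , q , _ , low) → q λ (_ , ¬accₘ) → ¬accₘ (acc λ { {y , yy} (ym , y≢m) →
              stable acc-irrelevant λ ¬accᵧ → y≢m (antisym W ym (low y (yy , ¬accᵧ) yy)) })
      ; compare     = compare
      }
      where
      compare : (p q : Field R) → _ ⊎ p ≡ q ⊎ _
      compare (x , xx) (y , yy) with x ≟ y
      ... | yes refl = inj₂ (inj₁ (cong (x ,_) (T-irrelevant xx yy)))
      ... | no x≢y   = Sum.map (_, x≢y) (λ yx → inj₂ (yx , x≢y ∘ sym)) (total W xx yy)

    recall : ∀ {R} → .(IsWellOrder R) → IsWellOrder R
    recall W = record
      { reflˡ   = λ xy → T-stable λ ¬xx → ⊥-elim-irr (¬xx (reflˡ W xy))
      ; reflʳ   = λ xy → T-stable λ ¬yy → ⊥-elim-irr (¬yy (reflʳ W xy))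
      ; antisym = λ xy yx → stable uip λ x≢y → ⊥-elim-irr (x≢y (antisym W xy yx))
      ; least   = λ S x∈S xx k → ⊥-elim-irr (least W S x∈S xx k)
      }

    module _ (next : ∀ {R} → IsWellOrder R → ∃[ x ] ¬ ⌜ R ⌝ x x) where

      -- Because `recall` takes its argument irrelevantly, the chosen element depends on `R` alone
      -- and not on the proof that `R` is a well-order; this gives `next-unique`.
      Next : Relation → B → Set a
      Next R x = Σ (IsWellOrder R) λ W → proj₁ (next (recall W)) ≡ x

      next-unique : ∀ {R x y} → Next R x → Next R y → x ≡ y
      next-unique (_ , refl) (_ , refl) = refl

      segment : Relation → B → Relation
      segment R x y z = ⟦ ⌜ R ⌝ y z × z <[ R ] x ⟧

      segment-intro : ∀ R {x y z} → ⌜ R ⌝ y z → z <[ R ] x → ⌜ segment R x ⌝ y z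
      segment-intro R yz z<x = ⟦⟧-intro (yz , z<x)

      segment-elim : ∀ R {x y z} → ⌜ segment R x ⌝ y z → ⌜ R ⌝ y z × z <[ R ] x
      segment-elim R = stable (λ (p , p′) (q , q′) → cong₂ _,_ (T-irrelevant p q) (<-irrelevant {R} p′ q′)) ∘ ⟦⟧-elim

      relation-ext : ∀ {R S : Relation} → (∀ y z → ⌜ R ⌝ y z → ⌜ S ⌝ y z) →
                     (∀ y z → ⌜ S ⌝ y z → ⌜ R ⌝ y z) → R ≡ S
      relation-ext f g = ext λ y → lower-extensionality 0ℓ a ext λ z → T-injective (f y z) (g y z)

      segment-segment : ∀ {R} → IsWellOrder R → ∀ {x y} → y <[ R ] x → segment (segment R x) y ≡ segment R y
      segment-segment {R} W {x} {y} y<x = relation-ext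
        (λ u v s → let s₁ , s₂ , v≢y = segment-elim (segment R x) s in
          segment-intro R (proj₁ (segment-elim R s₁)) (proj₁ (segment-elim R s₂) , v≢y))
        (λ u v s → let uv , vy , v≢y = segment-elim R s in
          segment-intro (segment R x) (segment-intro R uv (≤-<-trans W vy y<x)) (segment-intro R vy y<x , v≢y))

      -- These correspond to the γ-sets of Zermelo's proof.
      Good : Relation → Set a
      Good R = IsWellOrder R × (∀ x → ⌜ R ⌝ x x → ∥ Next (segment R x) x ∥)

      Agree : Relation → Relation → B → Set a
      Agree R S x = ⌜ R ⌝ x x × ⌜ S ⌝ x x × segment R x ≡ segment S x

      agree-sym : ∀ {R S x} → Agree R S x → Agree S R x
      agree-sym (p , q , e) = q , p , sym e

      <-transfer : ∀ {R S} → IsWellOrder R → ∀ {x y} → segment R x ≡ segment S x → y <[ R ] x → y <[ S ] x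
      <-transfer {R} {S} W {x} {y} e y<x =
        proj₂ (segment-elim S (subst (λ Q → ⌜ Q ⌝ y y) e (segment-intro R (reflˡ W (proj₁ y<x)) y<x)))

      agree-initial : ∀ {R S} → IsWellOrder R → IsWellOrder S → ∀ {x y} →
                      Agree R S x → y <[ R ] x → Agree R S y
      agree-initial {R} {S} W V {x} {y} (_ , _ , e) y<x = reflˡ W (proj₁ y<x) , reflˡ V (proj₁ y<′x) ,
        (begin
          segment R y             ≡⟨ segment-segment W y<x ⟨
          segment (segment R x) y ≡⟨ cong (λ Q → segment Q y) e ⟩
          segment (segment S x) y ≡⟨ segment-segment V y<′x ⟩
          segment S y             ∎)
        where
        y<′x = <-transfer {R} {S} W e y<x
        open ≡-Reasoning

      Covered : Relation → (B → Set a) → Set a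
      Covered R K = ∀ x → ⌜ R ⌝ x x → ∥ K x ∥

      LeastOutside : Relation → (B → Set a) → B → Set a
      LeastOutside R K x = ¬ K x × ⌜ R ⌝ x x × (∀ y → y <[ R ] x → ∥ K y ∥)

      leastOutside : ∀ {R} → IsWellOrder R → ∀ K → ¬ Covered R K → ∥ ∃ (LeastOutside R K) ∥
      leastOutside W K ¬cov k = ¬cov λ x xx ¬Kx → leastSuch W (¬_ ∘ K) ¬Kx xx λ (m , ¬¬¬Km , mm , low) →
        k (m , (λ Km → ¬¬¬Km λ ¬Km → ¬Km Km) , mm ,
           λ y (ym , y≢m) ¬Ky → y≢m (antisym W ym (low y ¬Ky (reflˡ W ym))))

      -- Any `v` below `x` is a point of agreement, as `x` is least outside. If `x′` were at or
      -- below `v` in `S`, it would inherit the agreement, so `v` lies strictly below `x′`.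
      segment-⊆ : ∀ {R S} → IsWellOrder R → IsWellOrder S → ∀ {x x′} →
                  LeastOutside R (Agree R S) x → LeastOutside S (Agree R S) x′ →
                  ∀ u v → ⌜ segment R x ⌝ u v → ⌜ segment S x′ ⌝ u v
      segment-⊆ {R} {S} W V {x} {x′} (_ , _ , below) (¬Kx′ , x′x′ , _) u v s = T-stable λ ¬goal →
        let uv , v<x = segment-elim R s in below v v<x λ Kv@(_ , vv , e) →
        let v≢x′ : v ≢ x′
            v≢x′ = λ { refl → ¬Kx′ Kv }
            uv′ : Dec (u ≡ v) → ⌜ S ⌝ u v
            uv′ = λ { (yes refl) → vv ; (no u≢v) → proj₁ (<-transfer {R} {S} W e (uv , u≢v)) }
        in case total V vv x′x′ of λ
          { (inj₁ vx′) → ¬goal (segment-intro S (uv′ (u ≟ v)) (vx′ , v≢x′))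
          ; (inj₂ x′v) → ¬Kx′ (agree-sym (agree-initial V W (agree-sym Kv) (x′v , v≢x′ ∘ sym))) }

      -- Otherwise each order has a least point of disagreement, and the segments below these two
      -- points are equal. Then `next` chooses the same point for both, and the orders agree there
      -- after all.
      covered : ∀ {R S} → Good R → Good S → ¬ Covered R (Agree R S) → ¬ ¬ Covered S (Agree R S)
      covered {R} {S} (W , nextR) (V , nextS) ¬covR ¬covS =
        leastOutside W _ ¬covR λ (x , out@(¬Kx , xx , below)) →
        leastOutside V _ ¬covS λ (x′ , out′@(¬Kx′ , x′x′ , below′)) →
        let flip : ∀ {Q z} → LeastOutside Q (Agree R S) z → LeastOutside Q (Agree S R) z
            flip = λ (¬K , zz , b) → ¬K ∘ agree-sym , zz , λ y l ¬K′ → b y l (¬K′ ∘ agree-sym)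
            e : segment R x ≡ segment S x′
            e = relation-ext (segment-⊆ W V out out′) (segment-⊆ V W (flip {S} out′) (flip {R} out))
        in nextR x xx λ n → nextS x′ x′x′ λ n′ →
          case next-unique n (subst (λ Q → Next Q x′) (sym e) n′) of λ { refl → ¬Kx (xx , x′x′ , e) }

      segments-agree : ∀ {R S} → Good R → Good S → ∀ {x} → ⌜ R ⌝ x x → ⌜ S ⌝ x x → segment R x ≡ segment S x
      segments-agree G H xx xx′ = stable uip λ ≢ → covered G H
        (λ cov → cov _ xx λ (_ , _ , e) → ≢ e) (λ cov → cov _ xx′ λ (_ , _ , e) → ≢ e)

      fields-nested : ∀ {R S} → Good R → Good S → ∀ {x y} → ⌜ R ⌝ x x → ¬ ⌜ S ⌝ x x → ⌜ S ⌝ y y → ⌜ R ⌝ y y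
      fields-nested G H xx ¬xx′ yy′ = T-stable λ ¬yy → covered G H
        (λ cov → cov _ xx λ (_ , xx′ , _) → ¬xx′ xx′) (λ cov → cov _ yy′ λ (yy , _) → ¬yy yy)

      ⋃Good : Relation
      ⋃Good x y = ⟦ ∃[ R ] (Good R × ⌜ R ⌝ x y) ⟧

      ⋃-intro : ∀ {R} → Good R → ∀ {x y} → ⌜ R ⌝ x y → ⌜ ⋃Good ⌝ x y
      ⋃-intro G xy = ⟦⟧-intro (_ , G , xy)

      -- Each good order is an initial segment of the union: a good `S` witnessing `y ≤ x` has the
      -- same segment below `x` as `R`.
      ⋃-local : ∀ {R} → Good R → ∀ {x y} → ⌜ R ⌝ x x → ⌜ ⋃Good ⌝ y x → ⌜ R ⌝ y x
      ⋃-local {R} G {x} {y} xx yx = T-stable λ ¬yx → ⟦⟧-elim yx λ (S , H , yx′) → case y ≟ x of λ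
        { (yes refl) → ¬yx xx
        ; (no y≢x)   → ¬yx (proj₁ (<-transfer {S} {R} (proj₁ H) (segments-agree H G (reflʳ (proj₁ H) yx′) xx) (yx′ , y≢x))) }

      ⋃-segment : ∀ {R} → Good R → ∀ {x} → ⌜ R ⌝ x x → segment ⋃Good x ≡ segment R x
      ⋃-segment {R} G xx = relation-ext
        (λ u v s → let uv , vx , v≢x = segment-elim ⋃Good s
                       vx′ = ⋃-local G xx vx
                   in segment-intro R (⋃-local G (reflˡ (proj₁ G) vx′) uv) (vx′ , v≢x))
        (λ u v s → let uv , vx , v≢x = segment-elim R s in
                   segment-intro ⋃Good (⋃-intro G uv) (⋃-intro G vx , v≢x))

      ⋃-isWellOrder : IsWellOrder ⋃Good
      ⋃-isWellOrder = record
        { reflˡ   = λ xy → T-stable λ ¬xx → ⟦⟧-elim xy λ (_ , G , xy′) → ¬xx (⋃-intro G (reflˡ (proj₁ G) xy′))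
        ; reflʳ   = λ xy → T-stable λ ¬yy → ⟦⟧-elim xy λ (_ , G , xy′) → ¬yy (⋃-intro G (reflʳ (proj₁ G) xy′))
        ; antisym = λ xy yx → stable uip λ x≢y → ⟦⟧-elim xy λ (_ , G , xy′) →
            x≢y (antisym (proj₁ G) xy′ (⋃-local G (reflˡ (proj₁ G) xy′) yx))
        -- The least element `m` within one good `R` is least overall: a `y` from another good `R′`
        -- either lies in `R` too or is above `m` in `R′`.
        ; least   = λ S x∈S xx k → ⟦⟧-elim xx λ (R , G , xx′) →
            least (proj₁ G) S x∈S xx′ λ (m , m∈S , mm , low) →
            k (m , m∈S , ⋃-intro G mm , λ y y∈S yy → T-stable λ ¬my → ⟦⟧-elim yy λ (R′ , H , yy′) →
              let below : ⌜ R ⌝ y y → ⊥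
                  below = λ yyᴿ → ¬my (⋃-intro G (low y y∈S yyᴿ))
              in case T? (R′ m m) of λ
                { (no ¬mm)  → below (fields-nested G H mm ¬mm yy′)
                ; (yes mm′) → case total (proj₁ H) mm′ yy′ of λ
                  { (inj₁ my) → ¬my (⋃-intro H my)
                  ; (inj₂ ym) → below (reflˡ (proj₁ G) (⋃-local G mm (⋃-intro H ym))) } })
        }

      ⋃-good : Good ⋃Good
      ⋃-good = ⋃-isWellOrder , λ x xx ¬next → ⟦⟧-elim xx λ (R , G , xx′) →
        proj₂ G x xx′ λ n → ¬next (subst (λ Q → Next Q x) (sym (⋃-segment G xx′)) n)

      module Extend {R : Relation} (G : Good R) where
        W = proj₁ G
        top = proj₁ (next (recall W))

        ¬top : ¬ ⌜ R ⌝ top top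
        ¬top = proj₂ (next (recall W))

        Extended : B → B → Set a
        Extended x y = ⌜ R ⌝ x y ⊎ (y ≡ top × (⌜ R ⌝ x x ⊎ x ≡ top))

        extended : Relation
        extended x y = ⟦ Extended x y ⟧

        old : ∀ {x y} → y ≢ top → ⌜ extended ⌝ x y → ⌜ R ⌝ x y
        old y≢top xy = T-stable λ ¬xy → ⟦⟧-elim xy λ
          { (inj₁ xy′)         → ¬xy xy′
          ; (inj₂ (y≡top , _)) → y≢top y≡top }

        ≢top : ∀ {x} → ⌜ R ⌝ x x → x ≢ top
        ≢top xx refl = ¬top xx

        extended-isWellOrder : IsWellOrder extended
        extended-isWellOrder = record
          { reflˡ   = λ xy → T-stable λ ¬xx → ⟦⟧-elim xy λ
              { (inj₁ xy′)               → ¬xx (⟦⟧-intro (inj₁ (reflˡ W xy′)))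
              ; (inj₂ (_ , inj₁ xx))     → ¬xx (⟦⟧-intro (inj₁ xx))
              ; (inj₂ (_ , inj₂ x≡top))  → ¬xx (⟦⟧-intro (inj₂ (x≡top , inj₂ x≡top))) }
          ; reflʳ   = λ xy → T-stable λ ¬yy → ⟦⟧-elim xy λ
              { (inj₁ xy′)         → ¬yy (⟦⟧-intro (inj₁ (reflʳ W xy′)))
              ; (inj₂ (y≡top , _)) → ¬yy (⟦⟧-intro (inj₂ (y≡top , inj₂ y≡top))) }
          ; antisym = λ xy yx → stable uip λ x≢y → ⟦⟧-elim xy λ
              { (inj₁ xy′) → x≢y (antisym W xy′ (old (≢top (reflˡ W xy′)) yx))
              ; (inj₂ (y≡top , inj₁ xx)) → ≢top (reflˡ W (old (≢top xx) yx)) y≡top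
              ; (inj₂ (y≡top , inj₂ x≡top)) → x≢y (trans x≡top (sym y≡top)) }
          -- If `S` contains a point of `R`, the least such point serves; otherwise `top` is the
          -- only point of the extended field in `S`, so `x` itself serves.
          ; least   = λ S {x} x∈S xx k →
              let none : ∀ y → y ∈ S → ¬ ⌜ R ⌝ y y
                  none = λ y y∈S yy → least W S y∈S yy λ (m , m∈S , mm , low) →
                    k (m , m∈S , ⟦⟧-intro (inj₁ mm) , λ z z∈S zz → T-stable λ ¬mz → ⟦⟧-elim zz λ
                      { (inj₁ zz′)         → ¬mz (⟦⟧-intro (inj₁ (low z z∈S zz′)))
                      ; (inj₂ (z≡top , _)) → ¬mz (⟦⟧-intro (inj₂ (z≡top , inj₁ mm))) })
              in k (x , x∈S , xx , λ y y∈S yy → T-stable λ ¬xy → ⟦⟧-elim xx λ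
                { (inj₁ xx′)         → none x x∈S xx′
                ; (inj₂ (x≡top , _)) → ⟦⟧-elim yy λ
                  { (inj₁ yy′)         → none y y∈S yy′
                  ; (inj₂ (y≡top , _)) → ¬xy (⟦⟧-intro (inj₂ (y≡top , inj₂ x≡top))) } })
          }

        segment-old : ∀ {x} → ⌜ R ⌝ x x → segment extended x ≡ segment R x
        segment-old xx = relation-ext
          (λ u v s → let uv , vx , v≢x = segment-elim extended s
                         vx′ = old (≢top xx) vx
                     in segment-intro R (old (≢top (reflˡ W vx′)) uv) (vx′ , v≢x))
          (λ u v s → let uv , vx , v≢x = segment-elim R s in
                     segment-intro extended (⟦⟧-intro (inj₁ uv)) (⟦⟧-intro (inj₁ vx) , v≢x))

        segment-top : segment extended top ≡ R
        segment-top = relation-ext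
          (λ u v s → let uv , _ , v≢top = segment-elim extended s in old v≢top uv)
          (λ u v uv → segment-intro extended (⟦⟧-intro (inj₁ uv))
            (⟦⟧-intro (inj₂ (refl , inj₁ (reflʳ W uv))) , ≢top (reflʳ W uv)))

        extended-good : Good extended
        extended-good = extended-isWellOrder , λ x xx ¬next → ⟦⟧-elim xx λ
          { (inj₁ xx′)        → proj₂ G x xx′ λ n → ¬next (subst (λ Q → Next Q x) (sym (segment-old xx′)) n)
          ; (inj₂ (refl , _)) → ¬next (subst (λ Q → Next Q x) (sym segment-top) (W , refl)) }

      no-next : ⊥
      no-next = ¬top (⋃-intro extended-good (⟦⟧-intro (inj₂ (refl , inj₂ refl))))
        where open Extend ⋃-good

  -- Diagonal argument against an injection of partitions into sequences.

  module _ {A : Set a} (ℕ↣A : DedekindInfinite A) (Partfin↣seq : Partfin A ↣ seq A) where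

    open Injection ℕ↣A using () renaming (to to f; injective to f-injective)
    open Injection Partfin↣seq using () renaming (to to g; injective to g-injective)

    Rest : Set a
    Rest = ∃[ x ] ¬ (∃[ n ] f n ≡ x)

    open Zermelo {Rest} using (Relation; ⌜_⌝; IsWellOrder; Field; fieldOrder; <-irrelevant; no-next)

    -- Cantor's diagonal argument: s is put into D exactly when the partition coded
    -- by s separates the two points left s and right s reserved for s.
    module Diagonal {R : Relation} (listCode : List (ℕ ⊎ Field R) ↣ (ℕ ⊎ Field R)) where

      open Injection listCode using () renaming (to to code; injective to code-injective)

      O : Set a
      O = ℕ ⊎ Field R

      ι : O → A
      ι (inj₁ n)             = f n
      ι (inj₂ ((x , _) , _)) = x

      ι-injective : Injective _≡_ _≡_ ι
      ι-injective {inj₁ _} {inj₁ _} e = cong inj₁ (f-injective e)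
      ι-injective {inj₁ _} {inj₂ ((_ , ¬nat) , _)} e = contradiction (-, e) ¬nat
      ι-injective {inj₂ ((_ , ¬nat) , _)} {inj₁ _} e = contradiction (-, sym e) ¬nat
      ι-injective {inj₂ ((x , p) , p′)} {inj₂ ((_ , q) , q′)} refl with refl ← ¬-irrelevant p q =
        cong (λ r → inj₂ ((x , p) , r)) (T-irrelevant p′ q′)

      -- The prefixed 0 or 1 separates the two sides, so the reserved points are distinct for
      -- different sequences and for different sides.
      left right : List O → A
      left s  = ι (code (inj₁ 0 ∷ s))
      right s = ι (code (inj₁ 1 ∷ s))

      left-injective : Injective _≡_ _≡_ left
      left-injective = ∷-injectiveʳ ∘ code-injective ∘ ι-injective

      right-injective : Injective _≡_ _≡_ right
      right-injective = ∷-injectiveʳ ∘ code-injective ∘ ι-injective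

      left≢right : ∀ s t → left s ≢ right t
      left≢right s t e = case ∷-injectiveˡ (code-injective (ι-injective e)) of λ ()

      D : 𝒫 (List O)
      D s = ⟦ ∃[ π ] (g π ≡ map ι s × ¬ Together π (left s) (right s)) ⟧

      merged-injective : Injective {A = ∃[ s ] s ∈ D} _≡_ _≡_ (left ∘ proj₁)
      merged-injective {s , p} {_ , q} e with refl ← left-injective e = cong (s ,_) (T-irrelevant p q)

      open Graft {I = ∃[ s ] s ∈ D} (left ∘ proj₁) (right ∘ proj₁) merged-injective
        (λ (s , _) (t , _) → left≢right s t)
        -- At most one point is moved to `z`, since `right` is injective. If the empty list fails,
        -- some `s` has `right s` equal to `z`, and the list of `left s` alone serves.
        (λ z ¬listed → ¬listed ([] , λ (s , _) e → ⊥-elim (¬listed (left s ∷ [] ,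
          λ (t , _) e′ → here (cong left (right-injective (trans e′ (sym e))))))))

      -- Suppose `s` codes the partition. If `s` is in `D`, injectivity of `g` says that the
      -- partition separates the two points of `s`, which it was built to merge. If not, neither
      -- point is moved, so the partition separates them, which puts `s` in `D`.
      diagonal : ∀ s → g partition ≢ map ι s
      diagonal s e = s∉D (⟦⟧-intro (partition , e , λ tog → left≢right s s
        (together-fixed (λ (t , t∈D) e′ → s∉D (subst (_∈ D) (left-injective e′) t∈D))
                        (λ (t , _) → left≢right t s) tog)))
        where
        s∉D : ¬ s ∈ D
        s∉D s∈D = ⟦⟧-elim s∈D λ (π , e′ , apart) →
          apart (subst (λ ρ → Together ρ (left s) (right s)) (g-injective (trans e (sym e′))) (together-graft (s , s∈D)))

      -- The search stops at the first entry outside the range of `ι`; if there were none, `xs`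
      -- would be an image under `map ι`. Injectivity of `ι` makes lying in the range a proposition,
      -- so `pem` decides it and yields the preimage.
      unlisted : ∀ xs → (∀ s → xs ≢ map ι s) → ∃[ x ] ¬ ⌜ R ⌝ x x
      unlisted []       outside = contradiction refl (outside [])
      unlisted (x ∷ xs) outside
        with pem (∃-irrelevant (λ o o′ p q → ι-injective (trans p (sym q))) (λ o → uip {x = ι o} {x}))
      ... | yes (o , refl) = unlisted xs (λ s e → outside (o ∷ s) (cong (ι o ∷_) e))
      ... | no ¬listed     = (x , λ (n , e) → ¬listed (inj₁ n , e)) , λ xx → ¬listed (inj₂ (_ , xx) , refl)

      next : ∃[ x ] ¬ ⌜ R ⌝ x x
      next = unlisted (g partition) diagonal

    Partfin↣̸seq : ⊥
    Partfin↣̸seq = no-next λ {R} W → Diagonal.next {R}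
      (ListCode.listCode (mk↣ {to = inj₁} inj₁-injective) (Pairing.pairing (fieldOrder W) (<-irrelevant {R})))

theorem2p6 : ∀ {a : Level} → Extensionality a a → PropositionalExcludedMiddle a →
    (A : Set a) → DedekindInfinite A → seq A ≺ Partfin A
theorem2p6 ext pem A ℕ↣A = seq↣Partfin ext pem ℕ↣A , no-bijection
  where
  no-bijection : ¬ (seq A ⤖ Partfin A)
  no-bijection seq⤖Partfin = Partfin↣̸seq ext pem ℕ↣A (mk↣ {to = from} λ {π} {ρ} e →
    trans (sym (to-from π)) (trans (cong to e) (to-from ρ)))
    where
    open Bijection seq⤖Partfin using (to; surjective)
    from : Partfin A → seq A
    from = proj₁ ∘ surjective
    to-from : ∀ π → to (from π) ≡ π
    to-from π = proj₂ (surjective π) refl
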